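{- For every integer $n \ge 1$, the intersection lattice $\mathcal{L}(\mathcal{H}_{2n-1})$ of the homogenized Linial arrangement $\mathcal{H}_{2n-1}$ and the bond lattice $\Pi_{\Gamma_{2n}}$ of the graph $\Gamma_{2n}$ are isomorphic as posets: $\mathcal{L}(\mathcal{H}_{2n-1}) \cong \Pi_{\Gamma_{2n}}$.
   Context: For $n\ge 1$, the homogenized Linial arrangement $\mathcal{H}_{2n-1}$ is the set of hyperplanes $\{x_i - x_j = y_i\}$, $1 \le i < j \le n+1$, in $\mathbb{R}^{2n+1}$ with coordinates $(x_1,\dots,x_{n+1},y_1,\dots,y_n)$. Its intersection lattice $\mathcal{L}(\mathcal{H}_{2n-1})$ is the set of all intersections of subsets of these hyperplanes (the empty intersection being the whole space), ordered by reverse inclusion. $\Gamma_{2n}$ is the bipartite graph on vertex set $[2n]=\{1,\dots,2n\}$ with edges $\{2i-1,2j\}$ for $1\le i\le j\le n$ (i.e. $u<v$ are adjacent iff $u$ is odd and $v$ is even). For a finite graph $G$ with vertex set $V$, the bond lattice $\Pi_G$ is the set of partitions $\pi$ of $V$ such that the induced subgraph of $G$ on each block of $\pi$ is connected, ordered by: $\pi\le\pi'$ iff every block of $\pi$ is contained in a block of $\pi'$. -}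

module Defs where

open import Data.Bool.Base using (Bool; T)
open import Data.Fin.Base using (Fin; toℕ; inject₁; _↑ˡ_; _↑ʳ_)
import Data.Fin.Base as Fin
open import Data.Fin.Subset using (Subset; _∈_; _⊆_; Nonempty)
open import Data.Fin.Subset.Properties using (⊆-antisym)
open import Data.Nat.Base as ℕ using (ℕ; suc; _+_; _*_; _∸_; _≥_; _⊔_)
import Data.Nat.Properties as ℕ
open import Data.Product.Base using (Σ; ∃-syntax; _×_; _,_; proj₂; swap)
open import Data.Rational.Base as ℚ using (ℚ; 0ℚ; ½; ∣_∣)
import Data.Rational.Properties as ℚ
open import Data.Rational.Solver using (module +-*-Solver)
open import Data.Sum.Base as Sum using (_⊎_)
open import Data.Vec.Functional using (Vector)
open import Level using (0ℓ) renaming (_⊔_ to _⊔ˡ_; suc to lsuc)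
open import Relation.Binary.Bundles using (Poset)
open import Relation.Binary.Core using (Rel)
open import Relation.Binary.Construct.Closure.ReflexiveTransitive using (Star)
open import Relation.Binary.Morphism.Structures using (IsOrderIsomorphism)
open import Relation.Binary.PropositionalEquality
  using (_≡_; refl; sym; trans; cong; subst)
open import Relation.Nullary.Negation using (¬_)
open import Relation.Unary using (Pred; _≐_) renaming (_⊆_ to _⊆′_)

------------------------------------------------------------------------
-- Isomorphism of posets

_≅_ : ∀ {a ℓ₁ ℓ₂ b ℓ₃ ℓ₄} → Poset a ℓ₁ ℓ₂ → Poset b ℓ₃ ℓ₄ →
      Set (a ⊔ˡ ℓ₁ ⊔ˡ ℓ₂ ⊔ˡ b ⊔ˡ ℓ₃ ⊔ˡ ℓ₄)
P ≅ Q = ∃[ f ] IsOrderIsomorphism P._≈_ Q._≈_ P._≤_ Q._≤_ f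
  where
  module P = Poset P
  module Q = Poset Q

------------------------------------------------------------------------
-- Real numbers: Cauchy sequences of rationals, two sequences being
-- equal (_≃_) when their difference tends to 0.

IsCauchy : (ℕ → ℚ) → Set
IsCauchy s = ∀ ε → 0ℚ ℚ.< ε →
  ∃[ N ] (∀ m n → m ≥ N → n ≥ N → ∣ s m ℚ.- s n ∣ ℚ.< ε)

record ℝ : Set where
  constructor mkℝ
  field
    seq    : ℕ → ℚ
    cauchy : IsCauchy seq

open ℝ public

infix 4 _≃_

_≃_ : Rel ℝ 0ℓ
x ≃ y = ∀ ε → 0ℚ ℚ.< ε →
  ∃[ N ] (∀ n → n ≥ N → ∣ seq x n ℚ.- seq y n ∣ ℚ.< ε)

private
  regroup : ∀ a b c d → (a ℚ.- b) ℚ.- (c ℚ.- d) ≡ (a ℚ.- c) ℚ.- (b ℚ.- d)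
  regroup = solve 4 (λ a b c d →
    (a :- b) :- (c :- d) := (a :- c) :- (b :- d)) refl
    where open +-*-Solver

  halves : ∀ ε → ½ ℚ.* ε ℚ.+ ½ ℚ.* ε ≡ ε
  halves ε = trans (sym (ℚ.*-distribʳ-+ ε ½ ½)) (ℚ.*-identityˡ ε)

  half-pos : ∀ {ε} → 0ℚ ℚ.< ε → 0ℚ ℚ.< ½ ℚ.* ε
  half-pos {ε} 0<ε = subst (ℚ._< ½ ℚ.* ε) (ℚ.*-zeroʳ ½) (ℚ.*-monoʳ-<-pos ½ 0<ε)

  ∣p-q∣≤∣p∣+∣q∣ : ∀ p q → ∣ p ℚ.- q ∣ ℚ.≤ ∣ p ∣ ℚ.+ ∣ q ∣
  ∣p-q∣≤∣p∣+∣q∣ p q = subst (λ r → ∣ p ℚ.- q ∣ ℚ.≤ ∣ p ∣ ℚ.+ r)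
    (ℚ.∣-p∣≡∣p∣ q) (ℚ.∣p+q∣≤∣p∣+∣q∣ p (ℚ.- q))

infixl 6 _-_

_-_ : ℝ → ℝ → ℝ
seq    (x - y) k = seq x k ℚ.- seq y k
cauchy (x - y) ε 0<ε
  with M , x-close ← cauchy x (½ ℚ.* ε) (half-pos 0<ε)
  with N , y-close ← cauchy y (½ ℚ.* ε) (half-pos 0<ε)
  = M ⊔ N , λ m n m≥ n≥ → begin-strict
    ∣ (seq x m ℚ.- seq y m) ℚ.- (seq x n ℚ.- seq y n) ∣
      ≡⟨ cong ∣_∣ (regroup (seq x m) (seq y m) (seq x n) (seq y n)) ⟩
    ∣ (seq x m ℚ.- seq x n) ℚ.- (seq y m ℚ.- seq y n) ∣
      ≤⟨ ∣p-q∣≤∣p∣+∣q∣ (seq x m ℚ.- seq x n) (seq y m ℚ.- seq y n) ⟩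
    ∣ seq x m ℚ.- seq x n ∣ ℚ.+ ∣ seq y m ℚ.- seq y n ∣
      <⟨ ℚ.+-mono-< (x-close m n (M≤ m≥) (M≤ n≥)) (y-close m n (N≤ m≥) (N≤ n≥)) ⟩
    ½ ℚ.* ε ℚ.+ ½ ℚ.* ε
      ≡⟨ halves ε ⟩
    ε ∎
  where
  open ℚ.≤-Reasoning
  M≤ : ∀ {k} → k ≥ M ⊔ N → k ≥ M
  M≤ = ℕ.≤-trans (ℕ.m≤m⊔n M N)
  N≤ : ∀ {k} → k ≥ M ⊔ N → k ≥ N
  N≤ = ℕ.≤-trans (ℕ.m≤n⊔m M N)

------------------------------------------------------------------------
-- Intersection lattice of an arrangement (H i)_{i : I} in ℝᵈ

module _ {I : Set} {d : ℕ} (H : I → Pred (Vector ℝ d) 0ℓ) where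

  -- A set of hyperplanes is given by its characteristic function; the
  -- empty set yields the whole space.
  ⋂ : (I → Bool) → Pred (Vector ℝ d) 0ℓ
  ⋂ S p = ∀ i → T (S i) → H i p

  -- An element of the lattice is a set of points; the subfamily that cuts
  -- it out is only required to exist and plays no role in ≈ or ≤ below.
  record Flat : Set₁ where
    field
      points         : Pred (Vector ℝ d) 0ℓ
      isIntersection : ∃[ S ] points ≐ ⋂ S

  open Flat

  intersectionLattice : Poset (lsuc 0ℓ) 0ℓ 0ℓ
  intersectionLattice = record
    { Carrier        = Flat
    ; _≈_            = λ X Y → points X ≐ points Y
    ; _≤_            = λ X Y → points Y ⊆′ points X
    ; isPartialOrder = record
      { isPreorder = record
        { isEquivalence = record
          { refl  = (λ p → p) , (λ p → p)
          ; sym   = swap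
          ; trans = λ (f , g) (h , k) → (λ p → h (f p)) , (λ p → g (k p))
          }
        ; reflexive = proj₂
        ; trans     = λ f g p → f (g p)
        }
      ; antisym = λ f g → g , f
      }
    }

-- Indices are 0-based: the pair i : Fin n, j : Fin (suc n) with
-- inject₁ i < j stands for 1 ≤ i+1 < j+1 ≤ n+1.
LinialIndex : ℕ → Set
LinialIndex n = Σ (Fin n × Fin (suc n)) λ (i , j) → inject₁ i Fin.< j

-- The first n + 1 coordinates of a point are the x's, the last n the y's.
linialHyperplane : ∀ n → LinialIndex n → Pred (Vector ℝ (suc n + n)) 0ℓ
linialHyperplane n ((i , j) , _) p = x (inject₁ i) - x j ≃ y i
  where
  x : Vector ℝ (suc n)
  x k = p (k ↑ˡ n)
  y : Vector ℝ n
  y k = p (suc n ↑ʳ k)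

𝓛-Linial : ℕ → Poset (lsuc 0ℓ) 0ℓ 0ℓ
𝓛-Linial n = intersectionLattice (linialHyperplane n)

------------------------------------------------------------------------
-- Bond lattice of a finite simple graph

record Graph (m : ℕ) : Set₁ where
  field
    Adj    : Rel (Fin m) 0ℓ
    symm   : ∀ {u v} → Adj u v → Adj v u
    irrefl : ∀ {v} → ¬ Adj v v

module _ {m : ℕ} (G : Graph m) where
  open Graph G

  InducedAdj : Subset m → Rel (Fin m) 0ℓ
  InducedAdj B u v = u ∈ B × v ∈ B × Adj u v

  Connected : Subset m → Set
  Connected B = ∀ {u v} → u ∈ B → v ∈ B → Star (InducedAdj B) u v

record Partition (m : ℕ) : Set₁ where
  field
    IsBlock  : Pred (Subset m) 0ℓ
    nonempty : ∀ {B} → IsBlock B → Nonempty B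
    covering : ∀ v → ∃[ B ] IsBlock B × v ∈ B
    disjoint : ∀ {B C v} → IsBlock B → IsBlock C → v ∈ B → v ∈ C → B ≡ C

open Partition public

_≼_ : ∀ {m} → Rel (Partition m) 0ℓ
π ≼ ρ = ∀ {B} → IsBlock π B → ∃[ C ] IsBlock ρ C × B ⊆ C

private
  -- Mutual refinement forces equality of the sets of blocks.
  ≼-antisym : ∀ {m} (π ρ : Partition m) → π ≼ ρ → ρ ≼ π →
              IsBlock π ⊆′ IsBlock ρ
  ≼-antisym π ρ π≼ρ ρ≼π {B} b
    with C , c , B⊆C ← π≼ρ b
    with D , d , C⊆D ← ρ≼π c
    with v , v∈B ← nonempty π b
    with refl ← disjoint π b d v∈B (C⊆D (B⊆C v∈B))
    = subst (IsBlock ρ) (⊆-antisym C⊆D B⊆C) c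

record Bond {m : ℕ} (G : Graph m) : Set₁ where
  field
    partition : Partition m
    connected : ∀ {B} → IsBlock partition B → Connected G B

open Bond public

bondLattice : ∀ {m} → Graph m → Poset (lsuc 0ℓ) 0ℓ 0ℓ
bondLattice G = record
  { Carrier        = Bond G
  ; _≈_            = λ π ρ → IsBlock (partition π) ≐ IsBlock (partition ρ)
  ; _≤_            = λ π ρ → partition π ≼ partition ρ
  ; isPartialOrder = record
    { isPreorder = record
      { isEquivalence = record
        { refl  = (λ b → b) , (λ b → b)
        ; sym   = swap
        ; trans = λ (f , g) (h , k) → (λ b → h (f b)) , (λ b → g (k b))
        }
      ; reflexive = λ (f , _) b → _ , f b , (λ v∈B → v∈B)
      ; trans     = λ π≼ρ ρ≼σ b →
          let _ , c , B⊆C = π≼ρ b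
              _ , d , C⊆D = ρ≼σ c
          in _ , d , (λ v∈B → C⊆D (B⊆C v∈B))
      }
    ; antisym = λ {π} {ρ} π≼ρ ρ≼π →
        ≼-antisym (partition π) (partition ρ) π≼ρ ρ≼π ,
        ≼-antisym (partition ρ) (partition π) ρ≼π π≼ρ
    }
  }

------------------------------------------------------------------------
-- The graph Γ₂ₙ

-- The vertex v : Fin (2 * n) carries the label toℕ v + 1 ∈ {1, …, 2n}.
label : ∀ {m} → Fin m → ℕ
label v = suc (toℕ v)

ΓEdge : ∀ n → Rel (Fin (2 * n)) 0ℓ
ΓEdge n u v = ∃[ i ] ∃[ j ] 1 ℕ.≤ i × i ℕ.≤ j × j ℕ.≤ n ×
              label u ≡ 2 * i ∸ 1 × label v ≡ 2 * j

private
  2i∸1<2j : ∀ {i j} → 1 ℕ.≤ i → i ℕ.≤ j → 2 * i ∸ 1 ℕ.< 2 * j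
  2i∸1<2j {suc i} {j} _ i≤j = ℕ.*-monoʳ-≤ 2 i≤j

  ΓEdge-irrefl : ∀ n {v} → ¬ ΓEdge n v v
  ΓEdge-irrefl n (i , j , 1≤i , i≤j , _ , p , q) =
    ℕ.<⇒≢ (2i∸1<2j 1≤i i≤j) (trans (sym p) q)

Γ : ∀ n → Graph (2 * n)
Γ n = record
  { Adj    = λ u v → ΓEdge n u v ⊎ ΓEdge n v u
  ; symm   = Sum.swap
  ; irrefl = Sum.[ ΓEdge-irrefl n , ΓEdge-irrefl n ]
  }

{-# OPTIONS --safe #-}

-- In the coordinates a_i = x_i − y_i and b_j = x_j (together with the free
-- coordinate x₁) the hyperplane x_i − x_j = y_i becomes a_i = b_j.  Attaching
-- a_i to the vertex 2i − 1 and b_j to the vertex 2(j − 1) turns the arrangement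
-- into the graphic arrangement of Γ₂ₙ.  A set S of edges is sent to the partition
-- into connected components of ([2n], S): the coordinates of a point of ⋂ S are
-- constant on components, and the indicator function of a component is a point
-- of ⋂ S separating it from the other components.
module Submission where

open import Defs
open import Data.Nat.Base using (ℕ; _≤_)
open import Data.Bool.Base using (Bool; T; if_then_else_)
open import Data.Fin.Base
  using (Fin; zero; suc; toℕ; fromℕ<; inject₁; cast; combine; remQuot; _↑ˡ_; _↑ʳ_)
open import Data.Fin.Properties
  using (_≟_; _<?_; <-irrelevant; toℕ-injective; toℕ-fromℕ<; toℕ-inject₁; toℕ<n; toℕ-cast; toℕ-combine;
         remQuot-combine; cast-involutive)
open import Data.Fin.Subset using (Subset; _∈_)
open import Data.Fin.Subset.Properties using (_∈?_; ⊆-antisym)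
open import Data.List.Base using (List; []; _∷_; allFin; cartesianProduct; concatMap; filter)
import Data.List.Membership.Propositional as List
open import Data.List.Membership.Propositional.Properties
  using (∈-allFin; ∈-cartesianProduct⁺; ∈-concatMap⁺; ∈-filter⁺; ∈-filter⁻)
open import Data.List.Relation.Unary.Any using (here; there)
open import Data.Nat.Base as ℕ using (suc; s≤s; z≤n; _+_; _*_; _∸_; _⊔_)
import Data.Nat.Properties as ℕ
open import Data.Product.Base using (∃-syntax; _×_; _,_; proj₁; proj₂)
open import Data.Rational.Base as ℚ using (ℚ; 0ℚ; 1ℚ; ½; ∣_∣)
import Data.Rational.Properties as ℚ
open import Data.Rational.Solver using (module +-*-Solver)
open import Data.Sum.Base using (inj₁; inj₂)
open import Data.Vec.Base using (tabulate)
open import Data.Vec.Functional using (Vector; _++_)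
open import Data.Vec.Functional.Properties using (lookup-++ˡ; lookup-++ʳ)
open import Data.Vec.Properties using (lookup∘tabulate; []=⇒lookup; lookup⇒[]=)
open import Function.Base using (_∘_)
open import Level using (0ℓ)
open import Relation.Binary.Bundles using (Poset)
open import Relation.Binary.Construct.Closure.ReflexiveTransitive using (Star; ε; _◅_; _◅◅_; reverse)
import Relation.Binary.Construct.On as On
open import Relation.Binary.Core using (Rel)
open import Relation.Binary.PropositionalEquality
  using (_≡_; _≢_; refl; sym; trans; cong; subst; subst₂; isEquivalence)
open import Relation.Binary.Structures using (IsEquivalence)
open import Relation.Nullary.Decidable
  using (yes; no; does; ⌊_⌋; T?; toWitness; fromWitness; dec-true; dec-false; decidable-stable)
open import Relation.Nullary.Negation using (¬_; contradiction)
open import Relation.Unary using (Pred)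

-- Real numbers

infix 4 _≋_

-- _≃_ unfolds to a Π-type, from which its arguments cannot be inferred.
record _≋_ (x y : ℝ) : Set where
  constructor wrap
  field unwrap : x ≃ y

open _≋_

≗⇒≋ : ∀ {x y} → (∀ k → seq x k ≡ seq y k) → x ≋ y
≗⇒≋ {x} {y} x≗y = wrap λ δ 0<δ → 0 , λ k _ →
  subst (ℚ._< δ) (cong ∣_∣ (sym (trans (cong (ℚ._- seq y k) (x≗y k)) (ℚ.+-inverseʳ (seq y k))))) 0<δ

≋-refl : ∀ {x} → x ≋ x
≋-refl = ≗⇒≋ λ _ → refl

≋-sym : ∀ {x y} → x ≋ y → y ≋ x
≋-sym {x} {y} (wrap x≃y) = wrap λ δ 0<δ →
  let N , close = x≃y δ 0<δ in
  N , λ k k≥N → subst (ℚ._< δ) (∣p-q∣≡∣q-p∣ (seq x k) (seq y k)) (close k k≥N)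
  where
  -[p-q]≡q-p : ∀ p q → ℚ.- (p ℚ.- q) ≡ q ℚ.- p
  -[p-q]≡q-p = solve 2 (λ p q → :- (p :- q) := q :- p) refl
    where open +-*-Solver
  ∣p-q∣≡∣q-p∣ : ∀ p q → ∣ p ℚ.- q ∣ ≡ ∣ q ℚ.- p ∣
  ∣p-q∣≡∣q-p∣ p q = trans (sym (ℚ.∣-p∣≡∣p∣ (p ℚ.- q))) (cong ∣_∣ (-[p-q]≡q-p p q))

≋-trans : ∀ {x y z} → x ≋ y → y ≋ z → x ≋ z
≋-trans {x} {y} {z} (wrap x≃y) (wrap y≃z) = wrap λ δ 0<δ →
  let 0<δ/2 = subst (ℚ._< ½ ℚ.* δ) (ℚ.*-zeroʳ ½) (ℚ.*-monoʳ-<-pos ½ 0<δ)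
      M , xy-close = x≃y (½ ℚ.* δ) 0<δ/2
      N , yz-close = y≃z (½ ℚ.* δ) 0<δ/2
  in M ⊔ N , λ k k≥ → begin-strict
    ∣ seq x k ℚ.- seq z k ∣
      ≡⟨ cong ∣_∣ (telescope (seq x k) (seq y k) (seq z k)) ⟩
    ∣ (seq x k ℚ.- seq y k) ℚ.+ (seq y k ℚ.- seq z k) ∣
      ≤⟨ ℚ.∣p+q∣≤∣p∣+∣q∣ (seq x k ℚ.- seq y k) (seq y k ℚ.- seq z k) ⟩
    ∣ seq x k ℚ.- seq y k ∣ ℚ.+ ∣ seq y k ℚ.- seq z k ∣
      <⟨ ℚ.+-mono-< (xy-close k (ℕ.≤-trans (ℕ.m≤m⊔n M N) k≥)) (yz-close k (ℕ.≤-trans (ℕ.m≤n⊔m M N) k≥)) ⟩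
    ½ ℚ.* δ ℚ.+ ½ ℚ.* δ
      ≡⟨ trans (sym (ℚ.*-distribʳ-+ δ ½ ½)) (ℚ.*-identityˡ δ) ⟩
    δ ∎
  where
  open ℚ.≤-Reasoning
  telescope : ∀ p q r → p ℚ.- r ≡ (p ℚ.- q) ℚ.+ (q ℚ.- r)
  telescope = solve 3 (λ p q r → p :- r := (p :- q) :+ (q :- r)) refl
    where open +-*-Solver

≋-isEquivalence : IsEquivalence _≋_
≋-isEquivalence = record { refl = ≋-refl ; sym = ≋-sym ; trans = ≋-trans }

-- Used in both directions to pass between the equation of a hyperplane, `x_i - x_j = y_i`, and its
-- graphic form `x_i - y_i = x_j`.
x-y≋z⇒x-z≋y : ∀ x y z → x - y ≋ z → x - z ≋ y
x-y≋z⇒x-z≋y x y z (wrap x-y≃z) = wrap λ δ 0<δ →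
  let N , close = x-y≃z δ 0<δ in
  N , λ k k≥N → subst (λ q → ∣ q ∣ ℚ.< δ) (exchange (seq x k) (seq y k) (seq z k)) (close k k≥N)
  where
  exchange : ∀ p q r → (p ℚ.- q) ℚ.- r ≡ (p ℚ.- r) ℚ.- q
  exchange = solve 3 (λ p q r → (p :- q) :- r := (p :- r) :- q) refl
    where open +-*-Solver

x-[x-y]≋y : ∀ {x y z w} → w ≡ x → z ≡ x - y → w - z ≋ y
x-[x-y]≋y {x} {y} refl refl = ≗⇒≋ λ k → cancel (seq x k) (seq y k)
  where
  cancel : ∀ p q → p ℚ.- (p ℚ.- q) ≡ q
  cancel = solve 2 (λ p q → p :- (p :- q) := q) refl
    where open +-*-Solver

const : ℚ → ℝ
const q = mkℝ (λ _ → q) λ δ 0<δ → 0 , λ _ _ _ _ →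
  subst (ℚ._< δ) (cong ∣_∣ (sym (ℚ.+-inverseʳ q))) 0<δ

1≄0 : ¬ (const 1ℚ ≋ const 0ℚ)
1≄0 (wrap 1≃0) with N , close ← 1≃0 1ℚ (toWitness {a? = 0ℚ ℚ.<? 1ℚ} _) =
  ℚ.<-irrefl refl (close N ℕ.≤-refl)

-- Partitions into fibres

module _ {m : ℕ} where

  fibre : (Fin m → Fin m) → Fin m → Subset m
  fibre c v = tabulate λ u → does (c u ≟ c v)

  ∈-fibre⁺ : ∀ c {u v} → c u ≡ c v → u ∈ fibre c v
  ∈-fibre⁺ c {u} {v} cu≡cv =
    lookup⇒[]= u _ (trans (lookup∘tabulate _ u) (dec-true (c u ≟ c v) cu≡cv))

  ∈-fibre⁻ : ∀ c {u v} → u ∈ fibre c v → c u ≡ c v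
  ∈-fibre⁻ c {u} {v} u∈ = decidable-stable (c u ≟ c v) λ cu≢cv →
    contradiction
      (trans (sym (dec-false (c u ≟ c v) cu≢cv)) (trans (sym (lookup∘tabulate _ u)) ([]=⇒lookup u∈)))
      λ ()

  fibre-cong : ∀ c {u v} → c u ≡ c v → fibre c u ≡ fibre c v
  fibre-cong c cu≡cv = ⊆-antisym
    (λ w∈ → ∈-fibre⁺ c (trans (∈-fibre⁻ c w∈) cu≡cv))
    (λ w∈ → ∈-fibre⁺ c (trans (∈-fibre⁻ c w∈) (sym cu≡cv)))

  fibres : (Fin m → Fin m) → Partition m
  fibres c = record
    { IsBlock  = λ B → ∃[ v ] B ≡ fibre c v
    ; nonempty = λ { (v , refl) → v , ∈-fibre⁺ c refl }
    ; covering = λ v → fibre c v , (v , refl) , ∈-fibre⁺ c refl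
    ; disjoint = λ { (_ , refl) (_ , refl) v∈B v∈C →
        fibre-cong c (trans (sym (∈-fibre⁻ c v∈B)) (∈-fibre⁻ c v∈C)) }
    }

  fibres-mono : ∀ c d → (∀ {u v} → c u ≡ c v → d u ≡ d v) → fibres c ≼ fibres d
  fibres-mono c d c⇒d (v , refl) =
    fibre d v , (v , refl) , λ u∈ → ∈-fibre⁺ d (c⇒d (∈-fibre⁻ c u∈))

  -- Both `u` and `v` lie in the fibre of `c` through `v`, which is contained in a single fibre of
  -- `d`.
  fibres-cancel : ∀ c d → fibres c ≼ fibres d → ∀ {u v} → c u ≡ c v → d u ≡ d v
  fibres-cancel c d c≼d {u} {v} cu≡cv with _ , (_ , refl) , ⊆D ← c≼d (v , refl) =
    trans (∈-fibre⁻ d (⊆D (∈-fibre⁺ c cu≡cv))) (sym (∈-fibre⁻ d (⊆D (∈-fibre⁺ c refl))))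

-- Connected components of a finite list of edges

module _ {E : Set} {m : ℕ} (s t : E → Fin m) where

  -- The kernel of merge es is the equivalence relation generated by es.
  merge : List E → Fin m → Fin m
  merge []       v = v
  merge (e ∷ es) v = if does (c v ≟ c (s e)) then c (t e) else c v
    where c = merge es

  -- Adding an edge moves the class of its source onto the value of its target, and that value stays
  -- fixed whether or not the two classes already agreed. The new map factors through the old one,
  -- so earlier identifications survive.
  merge-identifies : ∀ {e} es → e List.∈ es → merge es (s e) ≡ merge es (t e)
  merge-identifies {e} (e ∷ es) (here refl)
    rewrite dec-true (merge es (s e) ≟ merge es (s e)) refl
    with merge es (t e) ≟ merge es (s e)
  ... | yes _ = refl
  ... | no  _ = refl
  merge-identifies (e′ ∷ es) (there e∈es) rewrite merge-identifies es e∈es = refl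

  merge-least : ∀ {R : Rel (Fin m) 0ℓ} → IsEquivalence R → ∀ es →
                (∀ {e} → e List.∈ es → R (s e) (t e)) →
                ∀ {u v} → merge es u ≡ merge es v → R u v
  merge-least R-eq [] _ refl = IsEquivalence.refl R-eq
  merge-least {R} R-eq (e ∷ es) R-es {u} {v} = go
    where
    open IsEquivalence R-eq renaming (trans to _∙_; sym to _⁻¹; refl to R-refl)
    ih : ∀ {u v} → merge es u ≡ merge es v → R u v
    ih = merge-least R-eq es (R-es ∘ there)
    e-rel : R (s e) (t e)
    e-rel = R-es (here refl)
    go : merge (e ∷ es) u ≡ merge (e ∷ es) v → R u v
    go eq with merge es u ≟ merge es (s e) | merge es v ≟ merge es (s e)
    ... | yes p | yes q = ih (trans p (sym q))
    -- Only `u` was moved, so the chain from `u` to `v` passes through the new edge; the next case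
    -- is its mirror image.
    ... | yes p | no  _ = ih p ∙ (e-rel ∙ ih eq)
    ... | no  _ | yes q = ih eq ∙ ((e-rel ⁻¹) ∙ (ih q ⁻¹))
    ... | no  _ | no  _ = ih eq

module _ (n : ℕ) where

  open Flat

  H : LinialIndex n → Pred (Vector ℝ (suc n + n)) 0ℓ
  H = linialHyperplane n

  -- Vertices and edges of Γ₂ₙ

  vertex : Fin n → Fin 2 → Fin (2 * n)
  vertex k b = cast (ℕ.*-comm n 2) (combine k b)

  -- odd k and even k carry the labels 2k + 1 and 2k + 2, for k counted from 0.
  odd even : Fin n → Fin (2 * n)
  odd  k = vertex k zero
  even k = vertex k (suc zero)

  toℕ-vertex : ∀ k b → toℕ (vertex k b) ≡ 2 * toℕ k + toℕ b
  toℕ-vertex k b = trans (toℕ-cast _ (combine k b)) (toℕ-combine k b)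

  decode : Fin (2 * n) → Fin n × Fin 2
  decode v = remQuot 2 (cast (ℕ.*-comm 2 n) v)

  decode-vertex : ∀ k b → decode (vertex k b) ≡ (k , b)
  decode-vertex k b = trans
    (cong (remQuot 2) (cast-involutive (ℕ.*-comm 2 n) (ℕ.*-comm n 2) (combine k b)))
    (remQuot-combine k b)

  -- The inequality `inject₁ i < j` rules out `j = zero`. Lowering `suc j` to `j` turns it into
  -- `i ≤ j`, the adjacency condition of the graph.
  source target : LinialIndex n → Fin (2 * n)
  source ((i , _)     , _) = odd i
  target ((_ , suc j) , _) = even j

  label-odd : ∀ k → label (odd k) ≡ 2 * suc (toℕ k) ∸ 1
  label-odd k = trans (cong suc (trans (toℕ-vertex k zero) (ℕ.+-identityʳ _))) (sym (ℕ.+-suc _ _))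

  label-even : ∀ k → label (even k) ≡ 2 * suc (toℕ k)
  label-even k = trans (cong suc (trans (toℕ-vertex k (suc zero)) (ℕ.+-comm _ 1))) (sym (ℕ.*-suc 2 (toℕ k)))

  source-target-adjacent : ∀ e → ΓEdge n (source e) (target e)
  source-target-adjacent ((i , suc j) , s≤s i≤j) =
    suc (toℕ i) , suc (toℕ j) , s≤s z≤n , s≤s (subst (ℕ._≤ toℕ j) (toℕ-inject₁ i) i≤j) ,
    toℕ<n j , label-odd i , label-even j

  -- Converse to `source-target-adjacent`: the hyperplanes account for every edge of the graph. The
  -- witnesses are the 1-based `i` and `j` lowered by one.
  ΓEdge⇒index : ∀ {u v} → ΓEdge n u v → ∃[ e ] source e ≡ u × target e ≡ v
  ΓEdge⇒index {u} {v} (suc i , suc j , _ , s≤s i≤j , j<n , u-label , v-label) =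
    ((i′ , suc j′) , s≤s (subst₂ ℕ._≤_ (sym (trans (toℕ-inject₁ i′) (toℕ-fromℕ< i<n))) (sym (toℕ-fromℕ< j<n)) i≤j)) ,
    toℕ-injective (ℕ.suc-injective (trans (label-odd i′)
      (trans (cong (λ k → 2 * suc k ∸ 1) (toℕ-fromℕ< i<n)) (sym u-label)))) ,
    toℕ-injective (ℕ.suc-injective (trans (label-even j′)
      (trans (cong (λ k → 2 * suc k) (toℕ-fromℕ< j<n)) (sym v-label))))
    where
    i<n : i ℕ.< n
    i<n = ℕ.≤-<-trans i≤j j<n
    i′ j′ : Fin n
    i′ = fromℕ< i<n
    j′ = fromℕ< j<n

  -- Sets of hyperplanes are Boolean functions, whereas `merge` consumes a list; filtering this
  -- enumeration converts one into the other.
  indices : List (LinialIndex n)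
  indices = concatMap indexAt (cartesianProduct (allFin n) (allFin (suc n)))
    module Indices where
    indexAt : Fin n × Fin (suc n) → List (LinialIndex n)
    indexAt (i , j) with inject₁ i <? j
    ... | yes i<j = ((i , j) , i<j) ∷ []
    ... | no  _   = []

  ∈-indices : ∀ e → e List.∈ indices
  ∈-indices ((i , j) , i<j) =
    ∈-concatMap⁺ Indices.indexAt (List.lose (∈-cartesianProduct⁺ (∈-allFin i) (∈-allFin j)) ∈-indexAt)
    where
    ∈-indexAt : ((i , j) , i<j) List.∈ Indices.indexAt (i , j)
    ∈-indexAt with inject₁ i <? j
    -- The enumerated index carries the decided proof `q` instead of `i<j`; proofs of the inequality
    -- are all equal.
    ... | yes q  = here (cong ((i , j) ,_) (<-irrelevant i<j q))
    ... | no i≮j = contradiction i<j i≮j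

  -- The component partition of a set of hyperplanes

  module _ (S : LinialIndex n → Bool) where

    component : Fin (2 * n) → Fin (2 * n)
    component = merge source target (filter (T? ∘ S) indices)

    component-identifies : ∀ {e} → T (S e) → component (source e) ≡ component (target e)
    component-identifies {e} Se =
      merge-identifies source target _ (∈-filter⁺ (T? ∘ S) (∈-indices e) Se)

    -- The minimality of the component relation. It is applied below to joinability by paths and to
    -- the kernels of `component S′`, `value p` and `blockOf`.
    component-least : ∀ {R : Rel (Fin (2 * n)) 0ℓ} → IsEquivalence R →
                      (∀ {e} → T (S e) → R (source e) (target e)) →
                      ∀ {u v} → component u ≡ component v → R u v
    component-least R-eq R-S =
      merge-least source target R-eq _ λ e∈ → R-S (proj₂ (∈-filter⁻ (T? ∘ S) {xs = indices} e∈))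

    fibre-connected : ∀ w → Connected (Γ n) (fibre component w)
    fibre-connected w u∈ v∈ =
      stay u∈ (path (trans (∈-fibre⁻ component u∈) (sym (∈-fibre⁻ component v∈))))
      where
      -- Recording the component at each step ensures that a path starting in a fibre never leaves
      -- it.
      Step : Rel (Fin (2 * n)) 0ℓ
      Step u v = Graph.Adj (Γ n) u v × component u ≡ component v
      path : ∀ {u v} → component u ≡ component v → Star Step u v
      path = component-least
        (record { refl = ε ; sym = reverse (λ (a , eq) → Graph.symm (Γ n) a , sym eq) ; trans = _◅◅_ })
        (λ {e} Se → (inj₁ (source-target-adjacent e) , component-identifies Se) ◅ ε)
      stay : ∀ {u v} → u ∈ fibre component w → Star Step u v → Star (InducedAdj (Γ n) (fibre component w)) u v
      stay u∈ ε = ε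
      stay u∈ ((adj , eq) ◅ steps) = (u∈ , next∈ , adj) ◅ stay next∈ steps
        where next∈ = ∈-fibre⁺ component (trans (sym eq) (∈-fibre⁻ component u∈))

    componentBond : Bond (Γ n)
    componentBond = record
      { partition = fibres component
      ; connected = λ { (w , refl) → fibre-connected w }
      }

  -- Graphic coordinates

  coordinate : Vector ℝ (suc n + n) → Fin n × Fin 2 → ℝ
  coordinate p (k , zero)  = p (inject₁ k ↑ˡ n) - p (suc n ↑ʳ k)
  coordinate p (k , suc _) = p (suc k ↑ˡ n)

  value : Vector ℝ (suc n + n) → Fin (2 * n) → ℝ
  value p = coordinate p ∘ decode

  value-vertex : ∀ p k b → value p (vertex k b) ≡ coordinate p (k , b)
  value-vertex p k b = cong (coordinate p) (decode-vertex k b)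

  hyperplane⇒≋ : ∀ p e → H e p → value p (source e) ≋ value p (target e)
  hyperplane⇒≋ p ((i , suc j) , _) h =
    subst₂ _≋_ (sym (value-vertex p i zero)) (sym (value-vertex p j (suc zero)))
      (x-y≋z⇒x-z≋y (p (inject₁ i ↑ˡ n)) (p (suc j ↑ˡ n)) (p (suc n ↑ʳ i)) (wrap h))

  ≋⇒hyperplane : ∀ p e → value p (source e) ≋ value p (target e) → H e p
  ≋⇒hyperplane p ((i , suc j) , _) eq =
    unwrap (x-y≋z⇒x-z≋y (p (inject₁ i ↑ˡ n)) (p (suc n ↑ʳ i)) (p (suc j ↑ˡ n))
      (subst₂ _≋_ (value-vertex p i zero) (value-vertex p j (suc zero)) eq))

  -- Stated for an abstract p: on a concrete point, comparing differences of reals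
  -- makes the type checker normalise their Cauchy proofs.
  value-odd : ∀ p k {x y} → p (inject₁ k ↑ˡ n) ≡ x → p (suc n ↑ʳ k) ≡ x - y → value p (odd k) ≋ y
  value-odd p k {y = y} x-eq y-eq =
    subst (_≋ y) (sym (value-vertex p k zero)) (x-[x-y]≋y x-eq y-eq)

  value-even : ∀ p k {x} → p (suc k ↑ˡ n) ≡ x → value p (even k) ≋ x
  value-even p k refl = subst (_≋ p (suc k ↑ˡ n)) (sym (value-vertex p k (suc zero))) ≋-refl

  -- Points with prescribed graphic coordinates

  module _ (f : Fin (2 * n) → ℝ) where

    pointX : Vector ℝ (suc n)
    -- The first coordinate is attached to no even vertex; 0 is an arbitrary choice.
    pointX zero    = const 0ℚ
    pointX (suc k) = f (even k)

    -- The solution of `x_k - y_k = f (odd k)` for `y_k`.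
    pointY : Vector ℝ n
    pointY k = pointX (inject₁ k) - f (odd k)

    point : Vector ℝ (suc n + n)
    point = pointX ++ pointY

    value-point-odd : ∀ k → value point (odd k) ≋ f (odd k)
    value-point-odd k = value-odd point k (lookup-++ˡ pointX pointY (inject₁ k)) (lookup-++ʳ pointX pointY k)

    value-point-even : ∀ k → value point (even k) ≋ f (even k)
    value-point-even k = value-even point k (lookup-++ˡ pointX pointY (suc k))

    value-point-source : ∀ e → value point (source e) ≋ f (source e)
    value-point-source ((i , _) , _) = value-point-odd i

    value-point-target : ∀ e → value point (target e) ≋ f (target e)
    value-point-target ((_ , suc j) , _) = value-point-even j

    point∈hyperplane : ∀ e → f (source e) ≋ f (target e) → H e point
    point∈hyperplane e eq = ≋⇒hyperplane point e
      (≋-trans (value-point-source e) (≋-trans eq (≋-sym (value-point-target e))))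

    point∈hyperplane⁻ : ∀ e → H e point → f (source e) ≋ f (target e)
    point∈hyperplane⁻ e h =
      ≋-trans
        (≋-sym (value-point-source e))
        (≋-trans
          (hyperplane⇒≋ point e h) (value-point-target e))

  -- Inclusion of intersections and refinement of component partitions

  component-mono : ∀ S S′ → (∀ p → ⋂ H S′ p → ⋂ H S p) →
                   ∀ {u v} → component S u ≡ component S v → component S′ u ≡ component S′ v
  component-mono S S′ ⋂S′⊆⋂S = component-least S (On.isEquivalence c isEquivalence) λ {e} Se →
    -- If `e` joined two components of `S′`, the indicator of the one containing `source e` would
    -- give a point of `⋂ H S′` outside `H e`.
    decidable-stable (c (source e) ≟ c (target e)) λ s≁t → separate e s≁t (⋂S′⊆⋂S (point (χ e)) (point∈⋂ e) e Se)
    where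
    c = component S′
    χ : LinialIndex n → Fin (2 * n) → ℝ
    χ e v = if does (c v ≟ c (source e)) then const 1ℚ else const 0ℚ
    point∈⋂ : ∀ e → ⋂ H S′ (point (χ e))
    -- `χ e` depends on a vertex only through its component, so it takes equal values at the ends of
    -- an edge of `S′`.
    point∈⋂ e e′ S′e′ = point∈hyperplane (χ e) e′
      (subst (χ e (source e′) ≋_)
        (cong (λ w → if does (w ≟ c (source e)) then const 1ℚ else const 0ℚ) (component-identifies S′ S′e′))
        (≋-refl))
    separate : ∀ e → c (source e) ≢ c (target e) → ¬ H e (point (χ e))
    separate e s≁t h = 1≄0 (subst₂ (λ b b′ → (if b then const 1ℚ else const 0ℚ) ≋ (if b′ then const 1ℚ else const 0ℚ))
      (dec-true (c (source e) ≟ c (source e)) refl)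
      (dec-false (c (target e) ≟ c (source e)) (s≁t ∘ sym))
      (point∈hyperplane⁻ (χ e) e h))

  -- The graphic coordinates of a point of `⋂ H S′` are constant on the components of `S′`, and the
  -- hypothesis puts both ends of each edge of `S` into one such component.
  component-cancel : ∀ S S′ → (∀ {u v} → component S u ≡ component S v → component S′ u ≡ component S′ v) →
                     ∀ p → ⋂ H S′ p → ⋂ H S p
  component-cancel S S′ S⇒S′ p p∈ e Se = ≋⇒hyperplane p e
    (component-least S′ (On.isEquivalence (value p) ≋-isEquivalence)
      (λ {e′} S′e′ → hyperplane⇒≋ p e′ (p∈ e′ S′e′))
      (S⇒S′ (component-identifies S Se)))

  -- The map from flats to bonds

  module P = Poset (𝓛-Linial n)
  module Q = Poset (bondLattice (Γ n))

  flatBond : Flat H → Bond (Γ n)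
  flatBond X = componentBond (proj₁ (isIntersection X))

  flatBond-mono : ∀ {X Y} → X P.≤ Y → flatBond X Q.≤ flatBond Y
  flatBond-mono {X} {Y} Y⊆X =
    let S  , X⊆ , _  = isIntersection X
        S′ , _  , ⊆Y = isIntersection Y
    in fibres-mono (component S) (component S′) (component-mono S S′ λ p p∈ → X⊆ {p} (Y⊆X {p} (⊆Y {p} p∈)))

  flatBond-cancel : ∀ {X Y} → flatBond X Q.≤ flatBond Y → X P.≤ Y
  flatBond-cancel {X} {Y} π≼ρ {p} p∈Y =
    let S  , _  , ⊆X = isIntersection X
        S′ , Y⊆ , _  = isIntersection Y
    in ⊆X {p} (component-cancel S S′ (fibres-cancel (component S) (component S′) π≼ρ) p (Y⊆ {p} p∈Y))

  -- Equal point sets may carry different defining subfamilies; monotonicity both ways shows that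
  -- the bond does not depend on this choice.
  flatBond-cong : ∀ {X Y} → X P.≈ Y → flatBond X Q.≈ flatBond Y
  flatBond-cong {X} {Y} X≈Y =
    Q.antisym {flatBond X} {flatBond Y}
      (flatBond-mono {X} {Y} (P.reflexive {X} {Y} X≈Y))
      (flatBond-mono {Y} {X} (P.reflexive {Y} {X} (P.Eq.sym {X} {Y} X≈Y)))

  -- Every bond comes from a flat

  module _ (π : Bond (Γ n)) where

    blockOf : Fin (2 * n) → Subset (2 * n)
    blockOf v = proj₁ (covering (partition π) v)

    blockOf-isBlock : ∀ v → IsBlock (partition π) (blockOf v)
    blockOf-isBlock v = proj₁ (proj₂ (covering (partition π) v))

    ∈-blockOf : ∀ v → v ∈ blockOf v
    ∈-blockOf v = proj₂ (proj₂ (covering (partition π) v))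

    blockOf-unique : ∀ {B v} → IsBlock (partition π) B → v ∈ B → blockOf v ≡ B
    blockOf-unique {v = v} b v∈B = disjoint (partition π) (blockOf-isBlock v) b (∈-blockOf v) v∈B

    edgesWithin : LinialIndex n → Bool
    edgesWithin e = ⌊ target e ∈? blockOf (source e) ⌋

    bondFlat : Flat H
    bondFlat = record { points = ⋂ H edgesWithin ; isIntersection = edgesWithin , (λ p → p) , (λ p → p) }

    -- `blockOf` agrees at the ends of every selected edge, hence is constant on components.
    flatBond-bondFlat-≤ : flatBond bondFlat Q.≤ π
    flatBond-bondFlat-≤ (v , refl) = blockOf v , blockOf-isBlock v , λ {u} u∈ →
      subst (u ∈_)
        (component-least edgesWithin (On.isEquivalence blockOf isEquivalence)
          (λ {e} within → sym (blockOf-unique (blockOf-isBlock (source e)) (toWitness within)))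
          (∈-fibre⁻ (component edgesWithin) u∈))
        (∈-blockOf u)

    -- Connectedness of blocks enters here: a path inside a block uses only selected edges, so it
    -- stays in one component.
    flatBond-bondFlat-≥ : π Q.≤ flatBond bondFlat
    flatBond-bondFlat-≥ {B} b with v , v∈B ← nonempty (partition π) b =
      fibre c v , (v , refl) , λ u∈B → ∈-fibre⁺ c (along (connected π b u∈B v∈B))
      where
      c = component edgesWithin
      edge : ∀ {u w} → u ∈ B → w ∈ B → ΓEdge n u w → c u ≡ c w
      edge u∈B w∈B adj with e , refl , refl ← ΓEdge⇒index adj =
        component-identifies edgesWithin {e}
          (fromWitness (subst (target e ∈_) (sym (blockOf-unique b u∈B)) w∈B))
      along : ∀ {u w} → Star (InducedAdj (Γ n) B) u w → c u ≡ c w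
      along ε = refl
      along ((u∈B , w∈B , inj₁ adj) ◅ path) = trans (edge u∈B w∈B adj) (along path)
      along ((u∈B , w∈B , inj₂ adj) ◅ path) = trans (sym (edge w∈B u∈B adj)) (along path)

  linial≅bond : 𝓛-Linial n ≅ bondLattice (Γ n)
  linial≅bond = flatBond , record
    { isOrderMonomorphism = record
      { isOrderHomomorphism = record
        { cong = λ {X} {Y} → flatBond-cong {X} {Y}
        ; mono = λ {X} {Y} → flatBond-mono {X} {Y}
        }
      ; injective = λ {X} {Y} π≈ρ → P.antisym {X} {Y}
          (flatBond-cancel {X} {Y} (Q.reflexive {flatBond X} {flatBond Y} π≈ρ))
          (flatBond-cancel {Y} {X} (Q.reflexive {flatBond Y} {flatBond X}
            (Q.Eq.sym {flatBond X} {flatBond Y} π≈ρ)))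
      ; cancel = λ {X} {Y} → flatBond-cancel {X} {Y}
      }
    ; surjective = λ π → bondFlat π , λ {X} X≈ →
        Q.Eq.trans {flatBond X} {flatBond (bondFlat π)} {π} (flatBond-cong {X} {bondFlat π} X≈)
          (Q.antisym {flatBond (bondFlat π)} {π} (flatBond-bondFlat-≤ π) (flatBond-bondFlat-≥ π))
    }

theorem3p2 : (n : ℕ) → 1 ≤ n → 𝓛-Linial n ≅ bondLattice (Γ n)
theorem3p2 n _ = linial≅bond n
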